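{- Let $p$ be a prime and let $A\in \mathbb{Z}^{m\times n}$ be a matrix each of whose (square) subdeterminants belongs to $\{0\}\cup\{\pm p^k: k\in\mathbb{Z}_+\}$, and let $b\in \mathbb{Z}^m$. Then $Ax\leq b$ is totally dual $p$-adic.
   Context: $\mathbb{Z}_+$ denotes the nonnegative integers. A $p$-adic rational is a number of the form $a/p^k$ with $a,k$ integers and $k\geq 0$; a vector is $p$-adic if all its entries are $p$-adic rationals. The system $Ax\leq b$ is totally dual $p$-adic if for every $w\in\mathbb{Z}^n$ for which $\min\{b^\top y: A^\top y=w,\ y\geq \mathbf{0}\}$ has an optimal solution, it has a $p$-adic optimal solution.
   Formalization: The dual linear program min{bᵀy : Aᵀy = w, y ≥ 0} is taken over rational vectors y rather than real ones, both for the assumed optimal solution and for the feasible vectors it is compared with. -}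

module Defs where

open import Data.Nat as ℕ using (ℕ; zero; suc)
open import Data.Fin using (Fin; zero; suc; punchIn; toℕ)
import Data.Fin as Fin
open import Data.Integer as ℤ using (ℤ; +_; -_)
open import Data.Rational as ℚ using (ℚ; 0ℚ; _/_)
open import Data.Product using (Σ; ∃; _×_; _,_)
open import Data.Sum using (_⊎_)
open import Relation.Binary.PropositionalEquality using (_≡_)

Matℤ : ℕ → ℕ → Set
Matℤ m n = Fin m → Fin n → ℤ

∑ℤ : ∀ {n} → (Fin n → ℤ) → ℤ
∑ℤ {zero}  f = + 0
∑ℤ {suc n} f = f zero ℤ.+ ∑ℤ (λ i → f (suc i))

∑ℚ : ∀ {n} → (Fin n → ℚ) → ℚ
∑ℚ {zero}  f = 0ℚ
∑ℚ {suc n} f = f zero ℚ.+ ∑ℚ (λ i → f (suc i))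

ℤ→ℚ : ℤ → ℚ
ℤ→ℚ a = a / 1

sign : ℕ → ℤ
sign zero = + 1
sign (suc k) = - sign k

-- determinant by Laplace expansion along the first row
det : ∀ n → Matℤ n n → ℤ
det zero    M = + 1
det (suc n) M =
  ∑ℤ (λ j → sign (toℕ j) ℤ.* (M zero j ℤ.* det n (λ r c → M (suc r) (punchIn j c))))

-- strictly increasing index selection (a k-subset of Fin m, listed in order)
StrictlyIncreasing : ∀ {k m} → (Fin k → Fin m) → Set
StrictlyIncreasing f = ∀ i j → i Fin.< j → f i Fin.< f j

subMatrix : ∀ {m n k} → Matℤ m n → (Fin k → Fin m) → (Fin k → Fin n) → Matℤ k k
subMatrix A r c i j = A (r i) (c j)

SubdetsPowersOf : (p : ℕ) → ∀ {m n} → Matℤ m n → Set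
SubdetsPowersOf p {m} {n} A =
  ∀ k (r : Fin k → Fin m) (c : Fin k → Fin n) →
    StrictlyIncreasing r → StrictlyIncreasing c →
    (det k (subMatrix A r c) ≡ + 0)
    ⊎ (∃ λ t → det k (subMatrix A r c) ≡ + (p ℕ.^ t))
    ⊎ (∃ λ t → det k (subMatrix A r c) ≡ - (+ (p ℕ.^ t)))

IsPAdic : ℕ → ℚ → Set
IsPAdic p q = ∃ λ (a : ℤ) → ∃ λ (t : ℕ) → q ℚ.* ℤ→ℚ (+ (p ℕ.^ t)) ≡ ℤ→ℚ a

IsPAdicVec : ℕ → ∀ {m} → (Fin m → ℚ) → Set
IsPAdicVec p y = ∀ i → IsPAdic p (y i)

DualFeasible : ∀ {m n} → Matℤ m n → (Fin n → ℤ) → (Fin m → ℚ) → Set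
DualFeasible A w y =
  (∀ i → 0ℚ ℚ.≤ y i) × (∀ j → ∑ℚ (λ i → ℤ→ℚ (A i j) ℚ.* y i) ≡ ℤ→ℚ (w j))

dualObj : ∀ {m} → (Fin m → ℤ) → (Fin m → ℚ) → ℚ
dualObj b y = ∑ℚ (λ i → ℤ→ℚ (b i) ℚ.* y i)

DualOptimal : ∀ {m n} → Matℤ m n → (Fin m → ℤ) → (Fin n → ℤ) → (Fin m → ℚ) → Set
DualOptimal {m} A b w y =
  DualFeasible A w y × (∀ (y' : Fin m → ℚ) → DualFeasible A w y' → dualObj b y ℚ.≤ dualObj b y')

TotallyDualPAdic : ℕ → ∀ {m n} → Matℤ m n → (Fin m → ℤ) → Set
TotallyDualPAdic p {m} {n} A b =
  ∀ (w : Fin n → ℤ) →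
    (∃ λ (y : Fin m → ℚ) → DualOptimal A b w y) →
    ∃ λ (y : Fin m → ℚ) → DualOptimal A b w y × IsPAdicVec p y

{-# OPTIONS --safe #-}
module Submission where

-- Fix an optimal dual solution y. If some entry of y vanishes, drop that row of A and induct. If y > 0
-- and the rows of A are dependent, both directions of a dependency z are feasible at y, so optimality
-- makes the objective constant along z; moving along ± z until an entry vanishes reduces to the first
-- case. If the rows are independent, some maximal square submatrix is nonsingular, its determinant is
-- ± p^t, and Cramer's rule shows that the unique solution y is p-adic.
-- Cramer's rule is only needed for the first entry: once y₀ is p-adic, move its row to the right-hand
-- side and continue with a nonvanishing minor of the Laplace expansion along the first row.

open import Defs
open import Data.Nat as ℕ using (ℕ; zero; suc; z≤n; s≤s)
import Data.Nat.Properties as ℕ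
open import Data.Integer as ℤ using (ℤ)
import Data.Integer.Properties as ℤ
open import Data.Fin as Fin using (Fin; zero; suc; toℕ; punchIn)
import Data.Fin.Properties as Fin
open import Data.Nat.Primality using (Prime)
open import Data.Rational
open import Data.Rational.Properties
import Data.Rational.Unnormalised as ℚᵘ
import Data.Rational.Unnormalised.Properties as ℚᵘ
open import Data.Vec.Functional using (_∷_; insertAt)
open import Data.Vec.Functional.Properties using (insertAt-lookup; insertAt-punchIn)
open import Algebra.Bundles using (CommutativeRing)
import Algebra.Properties.Semiring.Sum as SemiringSum
open import Relation.Nullary.Decidable using (dec⇒maybe)
open import Data.Product using (∃; _×_; _,_; proj₁; proj₂)
open import Data.Sum using (_⊎_; inj₁; inj₂)
open import Data.Unit using (⊤)
open import Relation.Binary.Definitions using (tri<; tri≈; tri>)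
open import Function using (_∘_)
open import Relation.Nullary using (Dec; ¬_; ¬?; yes; no; contradiction; decidable-stable)
open import Relation.Binary.PropositionalEquality
open import Tactic.RingSolver using (solve-∀)
open import Tactic.RingSolver.Core.AlmostCommutativeRing using (AlmostCommutativeRing; fromCommutativeRing)

private
  variable
    m n k : ℕ

  module Sum = SemiringSum (CommutativeRing.semiring +-*-commutativeRing)

ring : AlmostCommutativeRing _ _
ring = fromCommutativeRing +-*-commutativeRing λ x → dec⇒maybe (0ℚ ≟ x)

-- Finite sums of rationals.

∑≡sum : (f : Fin n → ℚ) → ∑ℚ f ≡ Sum.sum f
∑≡sum {zero}  f = refl
∑≡sum {suc n} f = cong (λ x → f zero + x) (∑≡sum (f ∘ suc))

∑-cong : {f g : Fin n → ℚ} → (∀ i → f i ≡ g i) → ∑ℚ f ≡ ∑ℚ g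
∑-cong {zero}  f≗g = refl
∑-cong {suc n} f≗g = cong₂ _+_ (f≗g zero) (∑-cong (f≗g ∘ suc))

∑-zero : {f : Fin n → ℚ} → (∀ i → f i ≡ 0ℚ) → ∑ℚ f ≡ 0ℚ
∑-zero {zero}  f≗0 = refl
∑-zero {suc n} f≗0 = cong₂ _+_ (f≗0 zero) (∑-zero (f≗0 ∘ suc))

*-distribˡ-∑ : (a : ℚ) (f : Fin n → ℚ) → a * ∑ℚ f ≡ ∑ℚ (λ i → a * f i)
*-distribˡ-∑ a f = begin
  a * ∑ℚ f                 ≡⟨ cong (a *_) (∑≡sum f) ⟩
  a * Sum.sum f            ≡⟨ Sum.*-distribˡ-sum a f ⟩
  Sum.sum (λ i → a * f i)  ≡⟨ ∑≡sum (λ i → a * f i) ⟨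
  ∑ℚ (λ i → a * f i)       ∎
  where open ≡-Reasoning

∑-neg : (f : Fin n → ℚ) → ∑ℚ (λ i → - f i) ≡ - ∑ℚ f
∑-neg {zero}  f = refl
∑-neg {suc n} f = trans (cong (λ x → - f zero + x) (∑-neg (f ∘ suc))) (sym (neg-distrib-+ (f zero) (∑ℚ (f ∘ suc))))

∑-linear : (f : Fin n → ℚ) (a : ℚ) (g : Fin n → ℚ) →
           ∑ℚ (λ i → f i + a * g i) ≡ ∑ℚ f + a * ∑ℚ g
∑-linear f a g = begin
  ∑ℚ (λ i → f i + a * g i)             ≡⟨ ∑≡sum (λ i → f i + a * g i) ⟩
  Sum.sum (λ i → f i + a * g i)        ≡⟨ Sum.∑-distrib-+ f (λ i → a * g i) ⟩
  Sum.sum f + Sum.sum (λ i → a * g i)  ≡⟨ cong₂ _+_ (∑≡sum f) (∑≡sum (λ i → a * g i)) ⟨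
  ∑ℚ f + ∑ℚ (λ i → a * g i)            ≡⟨ cong (∑ℚ f +_) (*-distribˡ-∑ a g) ⟨
  ∑ℚ f + a * ∑ℚ g                      ∎
  where open ≡-Reasoning

∑-comm : (f : Fin m → Fin n → ℚ) → ∑ℚ (λ i → ∑ℚ (f i)) ≡ ∑ℚ (λ j → ∑ℚ (λ i → f i j))
∑-comm f = begin
  ∑ℚ (λ i → ∑ℚ (f i))                    ≡⟨ ∑-cong (λ i → ∑≡sum (f i)) ⟩
  ∑ℚ (λ i → Sum.sum (f i))               ≡⟨ ∑≡sum (λ i → Sum.sum (f i)) ⟩
  Sum.sum (λ i → Sum.sum (f i))          ≡⟨ Sum.∑-comm f ⟩
  Sum.sum (λ j → Sum.sum (λ i → f i j))  ≡⟨ ∑≡sum (λ j → Sum.sum (λ i → f i j)) ⟨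
  ∑ℚ (λ j → Sum.sum (λ i → f i j))       ≡⟨ ∑-cong (λ j → ∑≡sum (λ i → f i j)) ⟨
  ∑ℚ (λ j → ∑ℚ (λ i → f i j))            ∎
  where open ≡-Reasoning

∑-remove : (i : Fin (suc n)) (f : Fin (suc n) → ℚ) → ∑ℚ f ≡ f i + ∑ℚ (f ∘ punchIn i)
∑-remove i f = begin
  ∑ℚ f                           ≡⟨ ∑≡sum f ⟩
  Sum.sum f                      ≡⟨ Sum.sum-remove {i = i} f ⟩
  f i + Sum.sum (f ∘ punchIn i)  ≡⟨ cong (f i +_) (∑≡sum (f ∘ punchIn i)) ⟨
  f i + ∑ℚ (f ∘ punchIn i)       ∎
  where open ≡-Reasoning

-- Case split at a removed index, and nonzero products in the rationals.

punchIn-elim : (P : Fin (suc n) → Set) (i : Fin (suc n)) → P i → (∀ j → P (punchIn i j)) → ∀ j → P j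
punchIn-elim P i Pi P∘punchIn j with i Fin.≟ j
... | yes refl = Pi
... | no i≢j   = subst P (Fin.punchIn-punchOut i≢j) (P∘punchIn (Fin.punchOut i≢j))

neg-involutive : ∀ x → - - x ≡ x
neg-involutive = solve-∀ ring

*-≢0 : ∀ {x y} → x ≢ 0ℚ → y ≢ 0ℚ → x * y ≢ 0ℚ
*-≢0 {x} {y} x≢0 y≢0 xy≡0 = y≢0 (begin
  y               ≡⟨ *-identityˡ y ⟨
  1ℚ * y          ≡⟨ cong (_* y) (*-inverseˡ x) ⟨
  1/ x * x * y    ≡⟨ *-assoc (1/ x) x y ⟩
  1/ x * (x * y)  ≡⟨ cong (1/ x *_) xy≡0 ⟩
  1/ x * 0ℚ       ≡⟨ *-zeroʳ (1/ x) ⟩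
  0ℚ              ∎)
  where
  open ≡-Reasoning
  instance
    x-nonZero : NonZero x
    x-nonZero = ≢-nonZero x≢0

-- The embedding of the integers into the rationals.

private
  -- The second argument of `mkℚᵘ` is the denominator minus one, so this is `i / 1`. Homomorphism
  -- laws are checked on such fractions, where no gcd gets divided out.
  ι : ℤ → ℚᵘ.ℚᵘ
  ι i = ℚᵘ.mkℚᵘ i 0

ℤ→ℚ-+ : ∀ a b → ℤ→ℚ (a ℤ.+ b) ≡ ℤ→ℚ a + ℤ→ℚ b
ℤ→ℚ-+ a b = toℚᵘ-injective (begin
  toℚᵘ (ℤ→ℚ (a ℤ.+ b))            ≈⟨ toℚᵘ-fromℚᵘ (ι (a ℤ.+ b)) ⟩
  ι (a ℤ.+ b)                     ≈⟨ ℚᵘ.*≡* (cong (ℤ._* ℤ.+ 1) (cong₂ ℤ._+_ (ℤ.*-identityʳ a) (ℤ.*-identityʳ b))) ⟨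
  ι a ℚᵘ.+ ι b                    ≈⟨ ℚᵘ.+-cong (toℚᵘ-fromℚᵘ (ι a)) (toℚᵘ-fromℚᵘ (ι b)) ⟨
  toℚᵘ (ℤ→ℚ a) ℚᵘ.+ toℚᵘ (ℤ→ℚ b)  ≈⟨ toℚᵘ-homo-+ (ℤ→ℚ a) (ℤ→ℚ b) ⟨
  toℚᵘ (ℤ→ℚ a + ℤ→ℚ b)            ∎)
  where open import Relation.Binary.Reasoning.Setoid ℚᵘ.≃-setoid

ℤ→ℚ-* : ∀ a b → ℤ→ℚ (a ℤ.* b) ≡ ℤ→ℚ a * ℤ→ℚ b
ℤ→ℚ-* a b = toℚᵘ-injective (begin
  toℚᵘ (ℤ→ℚ (a ℤ.* b))            ≈⟨ toℚᵘ-fromℚᵘ (ι (a ℤ.* b)) ⟩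
  ι a ℚᵘ.* ι b                    ≈⟨ ℚᵘ.*-cong (toℚᵘ-fromℚᵘ (ι a)) (toℚᵘ-fromℚᵘ (ι b)) ⟨
  toℚᵘ (ℤ→ℚ a) ℚᵘ.* toℚᵘ (ℤ→ℚ b)  ≈⟨ toℚᵘ-homo-* (ℤ→ℚ a) (ℤ→ℚ b) ⟨
  toℚᵘ (ℤ→ℚ a * ℤ→ℚ b)            ∎)
  where open import Relation.Binary.Reasoning.Setoid ℚᵘ.≃-setoid

ℤ→ℚ-neg : ∀ a → ℤ→ℚ (ℤ.- a) ≡ - ℤ→ℚ a
ℤ→ℚ-neg a = toℚᵘ-injective (begin
  toℚᵘ (ℤ→ℚ (ℤ.- a))    ≈⟨ toℚᵘ-fromℚᵘ (ι (ℤ.- a)) ⟩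
  ℚᵘ.- ι a              ≈⟨ ℚᵘ.-‿cong (toℚᵘ-fromℚᵘ (ι a)) ⟨
  ℚᵘ.- toℚᵘ (ℤ→ℚ a)     ≈⟨ toℚᵘ-homo‿- (ℤ→ℚ a) ⟨
  toℚᵘ (- ℤ→ℚ a)        ∎)
  where open import Relation.Binary.Reasoning.Setoid ℚᵘ.≃-setoid

-- Rational determinants and their alternation in the rows.

sgn : ℕ → ℚ
sgn zero    = 1ℚ
sgn (suc k) = - sgn k

detℚ : ∀ n → (Fin n → Fin n → ℚ) → ℚ
-- Takes only the rows below the one being expanded, so that the same vector of cofactors can be
-- paired with any row.
cofactor : (Fin n → Fin (suc n) → ℚ) → Fin (suc n) → ℚ
detℚ zero    M = 1ℚ
detℚ (suc n) M = ∑ℚ (λ j → M zero j * cofactor (M ∘ suc) j)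
cofactor {n} R j = sgn (toℕ j) * detℚ n (λ r c → R r (punchIn j c))

detℚ-cong : {M N : Fin n → Fin n → ℚ} → (∀ i j → M i j ≡ N i j) → detℚ n M ≡ detℚ n N
detℚ-cong {zero}  M≗N = refl
detℚ-cong {suc n} M≗N = ∑-cong λ j → cong₂ _*_ (M≗N zero j)
  (cong (sgn (toℕ j) *_) (detℚ-cong λ r c → M≗N (suc r) (punchIn j c)))

ℤ→ℚ-sign : ∀ k → ℤ→ℚ (sign k) ≡ sgn k
ℤ→ℚ-sign zero    = refl
ℤ→ℚ-sign (suc k) = trans (ℤ→ℚ-neg (sign k)) (cong -_ (ℤ→ℚ-sign k))

ℤ→ℚ-∑ : (f : Fin n → ℤ) → ℤ→ℚ (∑ℤ f) ≡ ∑ℚ (ℤ→ℚ ∘ f)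
ℤ→ℚ-∑ {zero}  f = refl
ℤ→ℚ-∑ {suc n} f = trans (ℤ→ℚ-+ (f zero) (∑ℤ (f ∘ suc))) (cong (λ x → ℤ→ℚ (f zero) + x) (ℤ→ℚ-∑ (f ∘ suc)))

ℤ→ℚ-det : (M : Matℤ n n) → ℤ→ℚ (det n M) ≡ detℚ n (λ i j → ℤ→ℚ (M i j))
ℤ→ℚ-det {zero}  M = refl
ℤ→ℚ-det {suc n} M = trans (ℤ→ℚ-∑ (λ j → sign (toℕ j) ℤ.* (M zero j ℤ.* D j))) (∑-cong λ j → begin
  ℤ→ℚ (sign (toℕ j) ℤ.* (M zero j ℤ.* D j))
    ≡⟨ ℤ→ℚ-* (sign (toℕ j)) (M zero j ℤ.* D j) ⟩
  ℤ→ℚ (sign (toℕ j)) * ℤ→ℚ (M zero j ℤ.* D j)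
    ≡⟨ cong₂ _*_ (ℤ→ℚ-sign (toℕ j)) (ℤ→ℚ-* (M zero j) (D j)) ⟩
  sgn (toℕ j) * (ℤ→ℚ (M zero j) * ℤ→ℚ (D j))
    ≡⟨ exchange (sgn (toℕ j)) (ℤ→ℚ (M zero j)) (ℤ→ℚ (D j)) ⟩
  ℤ→ℚ (M zero j) * (sgn (toℕ j) * ℤ→ℚ (D j))
    ≡⟨ cong (λ d → ℤ→ℚ (M zero j) * (sgn (toℕ j) * d)) (ℤ→ℚ-det (λ r c → M (suc r) (punchIn j c))) ⟩
  _ ∎)
  where
  open ≡-Reasoning
  D : Fin (suc n) → ℤ
  D j = det n (λ r c → M (suc r) (punchIn j c))
  exchange : ∀ x y z → x * (y * z) ≡ y * (x * z)
  exchange = solve-∀ ring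

-- With G j k a minor on the columns other than j and punchIn j k, this is the Laplace
-- expansion along two rows u and v.
expand₂ : (u v : Fin (suc n) → ℚ) → (Fin (suc n) → Fin n → ℚ) → ℚ
expand₂ u v G = ∑ℚ λ j → u j * (sgn (toℕ j) * ∑ℚ λ k → v (punchIn j k) * (sgn (toℕ k) * G j k))

-- G j k is unchanged when j and punchIn j k trade places.
DependsOnRemaining : (Fin (suc n) → Fin n → ℚ) → Set
DependsOnRemaining {zero}  G = ⊤
DependsOnRemaining {suc n} G =
  (∀ k → G zero k ≡ G (suc k) zero) × DependsOnRemaining (λ j k → G (suc j) (suc k))

-- Column zero is used by `u`, by `v`, or by neither. When `v` uses it, `u` sits one position later,
-- which gives the minus sign, and the hypothesis identifies the minors with those of the first
-- group. When neither does, both signs flip and cancel.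
expand₂-suc : (u v : Fin (suc (suc n)) → ℚ) (G : Fin (suc (suc n)) → Fin (suc n) → ℚ) →
  (∀ k → G zero k ≡ G (suc k) zero) →
  expand₂ u v G ≡
    u zero * ∑ℚ (λ k → v (suc k) * (sgn (toℕ k) * G zero k)) +
    (expand₂ (u ∘ suc) (v ∘ suc) (λ j k → G (suc j) (suc k)) +
     - v zero * ∑ℚ (λ k → u (suc k) * (sgn (toℕ k) * G zero k)))
expand₂-suc {n} u v G sym₀ = cong₂ _+_ (cong (u zero *_) (*-identityˡ _)) (begin
  ∑ℚ (λ j → u (suc j) * (- s j * (v zero * (1ℚ * G (suc j) zero) +
    ∑ℚ (λ k → v (suc (punchIn j k)) * (- s k * G (suc j) (suc k))))))
    ≡⟨ ∑-cong (λ j → trans (cong₂ (λ g x → u (suc j) * (- s j * (v zero * (1ℚ * g) + x)))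
                                   (sym (sym₀ j)) (inner j))
                           (rearrange (u (suc j)) (s j) (v zero) (G zero j) (X j))) ⟩
  ∑ℚ (λ j → u (suc j) * (s j * X j) + - v zero * (u (suc j) * (s j * G zero j)))
    ≡⟨ ∑-linear (λ j → u (suc j) * (s j * X j)) (- v zero) (λ j → u (suc j) * (s j * G zero j)) ⟩
  _ ∎)
  where
  open ≡-Reasoning
  s : ∀ {m} → Fin m → ℚ
  s i = sgn (toℕ i)
  X : Fin (suc n) → ℚ
  X j = ∑ℚ (λ k → v (suc (punchIn j k)) * (s k * G (suc j) (suc k)))
  pull : ∀ x y z → x * (- y * z) ≡ - (x * (y * z))
  pull = solve-∀ ring
  inner : ∀ j → ∑ℚ (λ k → v (suc (punchIn j k)) * (- s k * G (suc j) (suc k))) ≡ - X j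
  inner j = trans (∑-cong λ k → pull (v (suc (punchIn j k))) (s k) (G (suc j) (suc k))) (∑-neg (λ k → v (suc (punchIn j k)) * (s k * G (suc j) (suc k))))
  rearrange : ∀ a b c d e → a * (- b * (c * (1ℚ * d) + - e)) ≡ a * (b * e) + - c * (a * (b * d))
  rearrange = solve-∀ ring

-- Induction on the columns: exchanging `u` and `v` trades the two groups of `expand₂-suc` that
-- involve column zero, up to sign; the third group is the induction hypothesis.
expand₂-antisym : (u v : Fin (suc n) → ℚ) (G : Fin (suc n) → Fin n → ℚ) →
  DependsOnRemaining G → expand₂ u v G ≡ - expand₂ v u G
expand₂-antisym {zero}  u v G _ = trans (vanish (u zero)) (sym (cong -_ (vanish (v zero))))
  where
  vanish : ∀ x → x * 0ℚ + 0ℚ ≡ 0ℚ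
  vanish x = cong (_+ 0ℚ) (*-zeroʳ x)
expand₂-antisym {suc n} u v G (sym₀ , sym₊) = begin
  expand₂ u v G
    ≡⟨ expand₂-suc u v G sym₀ ⟩
  u zero * B + (expand₂ (u ∘ suc) (v ∘ suc) G₊ + - v zero * A)
    ≡⟨ cong (λ e → u zero * B + (e + - v zero * A)) (expand₂-antisym (u ∘ suc) (v ∘ suc) G₊ sym₊) ⟩
  u zero * B + (- E + - v zero * A)
    ≡⟨ rearrange (u zero) B E (v zero) A ⟩
  - (v zero * A + (E + - u zero * B))
    ≡⟨ cong -_ (expand₂-suc v u G sym₀) ⟨
  - expand₂ v u G ∎
  where
  open ≡-Reasoning
  G₊ : Fin (suc n) → Fin n → ℚ
  G₊ j k = G (suc j) (suc k)
  A B E : ℚ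
  A = ∑ℚ (λ k → u (suc k) * (sgn (toℕ k) * G zero k))
  B = ∑ℚ (λ k → v (suc k) * (sgn (toℕ k) * G zero k))
  E = expand₂ (v ∘ suc) (u ∘ suc) G₊
  rearrange : ∀ u b e v a → u * b + (- e + - v * a) ≡ - (v * a + (e + - u * b))
  rearrange = solve-∀ ring

-- Removing column zero and another column in either order leaves the list `suc (punchIn k i)`. For
-- later pairs column zero survives, so `F` is replaced by `F` with `zero` prepended. The second
-- hypothesis stands in for function extensionality.
dependsOnRemaining : (F : (Fin n → Fin (suc (suc n))) → ℚ) →
  (∀ {f g} → (∀ i → f i ≡ g i) → F f ≡ F g) →
  (G : Fin (suc (suc n)) → Fin (suc n) → ℚ) →
  (∀ j k → G j k ≡ F (λ i → punchIn j (punchIn k i))) → DependsOnRemaining G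
dependsOnRemaining {zero}  F ext G G≗F = (λ k → trans (G≗F zero k) (trans (ext λ ()) (sym (G≗F (suc k) zero)))) , _
dependsOnRemaining {suc n} F ext G G≗F =
  (λ k → trans (G≗F zero k) (trans (ext λ _ → refl) (sym (G≗F (suc k) zero)))) ,
  dependsOnRemaining (λ f → F (zero ∷ (suc ∘ f))) (λ f≗g → ext λ { zero → refl ; (suc i) → cong suc (f≗g i) })
    _ λ j k → trans (G≗F (suc j) (suc k)) (ext λ { zero → refl ; (suc i) → refl })

detℚ-swap : (u v : Fin (suc (suc n)) → ℚ) (R : Fin n → Fin (suc (suc n)) → ℚ) →
  detℚ (suc (suc n)) (u ∷ v ∷ R) ≡ - detℚ (suc (suc n)) (v ∷ u ∷ R)
detℚ-swap {n} u v R = expand₂-antisym u v (λ j k → minor (λ c → punchIn j (punchIn k c)))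
  (dependsOnRemaining minor (λ f≗g → detℚ-cong λ r c → cong (R r) (f≗g c)) _ λ _ _ → refl)
  where
  minor : (Fin n → Fin (suc (suc n))) → ℚ
  minor f = detℚ n λ r c → R r (f c)

x≡-x⇒x≡0 : ∀ {x} → x ≡ - x → x ≡ 0ℚ
x≡-x⇒x≡0 {x} x≡-x with <-cmp x 0ℚ
... | tri≈ _ x≡0 _ = x≡0
... | tri< x<0 _ _ = contradiction (subst (0ℚ <_) (sym x≡-x) (neg-antimono-< x<0)) (<-asym x<0)
... | tri> _ _ x>0 = contradiction (subst (_< 0ℚ) (sym x≡-x) (neg-antimono-< x>0)) (<-asym x>0)

-- The sum is the determinant of `R` with row `l` repeated on top. If `l` is zero, swapping the two
-- equal rows negates it. Otherwise a swap puts row zero on top, and every minor again has a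
-- repeated row on top.
cofactor-orthogonal : (R : Fin n → Fin (suc n) → ℚ) (l : Fin n) → ∑ℚ (λ j → R l j * cofactor R j) ≡ 0ℚ
cofactor-orthogonal {suc n} R zero    = x≡-x⇒x≡0 (detℚ-swap (R zero) (R zero) (R ∘ suc))
cofactor-orthogonal {suc n} R (suc l) = begin
  detℚ (suc (suc n)) (R (suc l) ∷ R zero ∷ (R ∘ suc))       ≡⟨ detℚ-swap (R (suc l)) (R zero) (R ∘ suc) ⟩
  - detℚ (suc (suc n)) (R zero ∷ R (suc l) ∷ (R ∘ suc))     ≡⟨ cong -_ (∑-zero minor≡0) ⟩
  0ℚ                                                        ∎
  where
  open ≡-Reasoning
  minor≡0 : ∀ j → R zero j * cofactor (R (suc l) ∷ (R ∘ suc)) j ≡ 0ℚ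
  minor≡0 j = trans
    (cong (λ d → R zero j * (sgn (toℕ j) * d)) (cofactor-orthogonal (λ r c → R (suc r) (punchIn j c)) l))
    (trans (cong (R zero j *_) (*-zeroʳ (sgn (toℕ j)))) (*-zeroʳ (R zero j)))

-- Linear combinations of rows and Cramer's rule for the first unknown.

∑-*-linear : (a y : Fin n → ℚ) (t : ℚ) (z : Fin n → ℚ) →
  ∑ℚ (λ i → a i * (y i + t * z i)) ≡ ∑ℚ (λ i → a i * y i) + t * ∑ℚ (λ i → a i * z i)
∑-*-linear a y t z = trans (∑-cong λ i → expand (a i) (y i) t (z i))
                           (∑-linear (λ i → a i * y i) t (λ i → a i * z i))
  where
  expand : ∀ a y t z → a * (y + t * z) ≡ a * y + t * (a * z)
  expand = solve-∀ ring

∑-*-neg : (a z : Fin n → ℚ) → ∑ℚ (λ i → a i * - z i) ≡ - ∑ℚ (λ i → a i * z i)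
∑-*-neg a z = trans (∑-cong λ i → sym (neg-distribʳ-* (a i) (z i))) (∑-neg (λ i → a i * z i))

-- The vector `Aᵀz`, the left-hand side of the dual equations; names such as `Az≡0` below refer to
-- it.
rowComb : (Fin m → Fin n → ℚ) → (Fin m → ℚ) → Fin n → ℚ
rowComb A z j = ∑ℚ (λ i → A i j * z i)

-- The adjoint identity between `Aᵀz` paired with `f` and `z` paired with `Af`, by exchanging the
-- sums.
∑-rowComb : (A : Fin m → Fin n → ℚ) (z : Fin m → ℚ) (f : Fin n → ℚ) →
  ∑ℚ (λ j → rowComb A z j * f j) ≡ ∑ℚ (λ i → z i * ∑ℚ (λ j → A i j * f j))
∑-rowComb A z f = begin
  ∑ℚ (λ j → rowComb A z j * f j)              ≡⟨ ∑-cong (λ j → trans (*-comm (rowComb A z j) (f j)) (*-distribˡ-∑ (f j) (λ i → A i j * z i))) ⟩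
  ∑ℚ (λ j → ∑ℚ (λ i → f j * (A i j * z i)))   ≡⟨ ∑-comm (λ j i → f j * (A i j * z i)) ⟩
  ∑ℚ (λ i → ∑ℚ (λ j → f j * (A i j * z i)))   ≡⟨ ∑-cong (λ i → ∑-cong λ j → rearrange (f j) (A i j) (z i)) ⟩
  ∑ℚ (λ i → ∑ℚ (λ j → z i * (A i j * f j)))   ≡⟨ ∑-cong (λ i → *-distribˡ-∑ (z i) (λ j → A i j * f j)) ⟨
  ∑ℚ (λ i → z i * ∑ℚ (λ j → A i j * f j))     ∎
  where
  open ≡-Reasoning
  rearrange : ∀ f a z → f * (a * z) ≡ z * (a * f)
  rearrange = solve-∀ ring

-- Every row below the first is orthogonal to these cofactors, and the first row pairs with them to
-- the determinant.
cramer₀ : (A : Fin (suc n) → Fin (suc n) → ℚ) (z : Fin (suc n) → ℚ) →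
  ∑ℚ (λ j → rowComb A z j * cofactor (A ∘ suc) j) ≡ z zero * detℚ (suc n) A
cramer₀ A z = begin
  ∑ℚ (λ j → rowComb A z j * C j)             ≡⟨ ∑-rowComb A z C ⟩
  z zero * D + ∑ℚ (λ i → z (suc i) * ∑ℚ (λ j → A (suc i) j * C j))
                                             ≡⟨ cong (λ x → z zero * D + x) (∑-zero λ i → trans (cong (z (suc i) *_) (cofactor-orthogonal (A ∘ suc) i)) (*-zeroʳ (z (suc i)))) ⟩
  z zero * D + 0ℚ                            ≡⟨ +-identityʳ (z zero * D) ⟩
  z zero * D                                 ∎
  where
  open ≡-Reasoning
  C : Fin _ → ℚ
  C = cofactor (A ∘ suc)
  D : ℚ
  D = detℚ _ A

-- Strictly increasing selections of columns.

∷-increasing : {x : Fin n} {c : Fin k → Fin n} →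
  (∀ i → x Fin.< c i) → StrictlyIncreasing c → StrictlyIncreasing (x ∷ c)
∷-increasing x<c c-inc zero    (suc j) _         = x<c j
∷-increasing x<c c-inc (suc i) (suc j) (s≤s i<j) = c-inc i j i<j

tail-increasing : {c : Fin (suc k) → Fin n} → StrictlyIncreasing c → StrictlyIncreasing (c ∘ suc)
tail-increasing c-inc i j i<j = c-inc (suc i) (suc j) (s≤s i<j)

-- `SubdetsPowersOf` speaks of increasing selections only, so a new column has to go to its sorted
-- position `q`.
insertSorted : (c : Fin k → Fin n) → StrictlyIncreasing c → (x : Fin n) → (∀ q → c q ≢ x) →
  ∃ λ (c⁺ : Fin (suc k) → Fin n) → ∃ λ q →
    StrictlyIncreasing c⁺ × c⁺ q ≡ x × (∀ i → c⁺ (punchIn q i) ≡ c i)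
insertSorted {zero}  c c-inc x c≢x = x ∷ c , zero , ∷-increasing (λ ()) c-inc , refl , λ ()
insertSorted {suc k} c c-inc x c≢x with Fin.<-cmp x (c zero)
... | tri≈ _ x≡c₀ _ = contradiction (sym x≡c₀) (c≢x zero)
... | tri< x<c₀ _ _ = x ∷ c , zero , ∷-increasing x<c c-inc , refl , λ _ → refl
  where
  x<c : ∀ i → x Fin.< c i
  x<c zero    = x<c₀
  x<c (suc i) = Fin.<-trans x<c₀ (c-inc zero (suc i) (s≤s z≤n))
... | tri> _ _ c₀<x with insertSorted (c ∘ suc) (tail-increasing c-inc) x (c≢x ∘ suc)
...   | c⁺ , q , c⁺-inc , c⁺q≡x , c⁺≗c =
  c zero ∷ c⁺ , suc q , ∷-increasing c₀<c⁺ c⁺-inc , c⁺q≡x , λ { zero → refl ; (suc i) → c⁺≗c i }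
  where
  c₀<c⁺ : ∀ i → c zero Fin.< c⁺ i
  c₀<c⁺ = punchIn-elim (λ i → c zero Fin.< c⁺ i) q (subst (c zero Fin.<_) (sym c⁺q≡x) c₀<x)
    λ i → subst (c zero Fin.<_) (sym (c⁺≗c i)) (c-inc zero (suc i) (s≤s z≤n))

-- Dependent rows or a nonsingular maximal submatrix.

sgn≢0 : ∀ k → sgn k ≢ 0ℚ
sgn≢0 zero    ()
sgn≢0 (suc k) eq = sgn≢0 k (neg-injective eq)

Dependent : (Fin m → Fin n → ℚ) → Set
Dependent A = ∃ λ z → (∃ λ i → z i ≢ 0ℚ) × (∀ j → rowComb A z j ≡ 0ℚ)

-- The solvability clause is redundant; it is what makes the induction on m go through.
record NonsingularColumns (A : Fin m → Fin n → ℚ) : Set where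
  field
    columns    : Fin m → Fin n
    increasing : StrictlyIncreasing columns
    det≢0      : detℚ m (λ i q → A i (columns q)) ≢ 0ℚ
    solve      : (v : Fin m → ℚ) → ∃ λ (z : Fin m → ℚ) → ∀ q → rowComb A z (columns q) ≡ v q

-- Gaussian elimination, one row at a time: subtract from the first row the combination of the
-- others that agrees with it on their columns. If nothing is left, this is a dependency; otherwise
-- any column with a nonzero remainder joins the selection.
dependent-or-nonsingular : (A : Fin m → Fin n → ℚ) → Dependent A ⊎ NonsingularColumns A
dependent-or-nonsingular {zero}  A = inj₂ record
  { columns = λ () ; increasing = λ () ; det≢0 = λ () ; solve = λ v → (λ ()) , λ () }
dependent-or-nonsingular {suc m} A with dependent-or-nonsingular (A ∘ suc)
... | inj₁ (z , (i , zᵢ≢0) , dep) =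
  inj₁ (0ℚ ∷ z , (suc i , zᵢ≢0) , λ j → cong₂ _+_ (*-zeroʳ (A zero j)) (dep j))
... | inj₂ N = extend
  where
  open ≡-Reasoning
  open NonsingularColumns N renaming (columns to c)

  z : Fin m → ℚ
  z = proj₁ (solve (A zero ∘ c))

  -- The leading 1 makes `d` nonzero, as a dependency requires, and makes `cramer₀` at `d` return
  -- the determinant itself.
  d : Fin (suc m) → ℚ
  d = 1ℚ ∷ (-_ ∘ z)

  -- The first row reduced by the other ones: it vanishes on the chosen columns.
  u : Fin _ → ℚ
  u = rowComb A d

  u∘c≡0 : ∀ q → u (c q) ≡ 0ℚ
  u∘c≡0 q = begin
    a * 1ℚ + ∑ℚ (λ i → A (suc i) (c q) * - z i)  ≡⟨ cong₂ _+_ (*-identityʳ a) (∑-*-neg (λ i → A (suc i) (c q)) z) ⟩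
    a + - rowComb (A ∘ suc) z (c q)              ≡⟨ cong (λ x → a + - x) (proj₂ (solve (A zero ∘ c)) q) ⟩
    a + - a                                      ≡⟨ +-inverseʳ a ⟩
    0ℚ                                           ∎
    where
    a : ℚ
    a = A zero (c q)

  extendBy : ∀ j → u j ≢ 0ℚ → NonsingularColumns A
  extendBy j uj≢0 with insertSorted c increasing j (λ q cq≡j → uj≢0 (subst (λ x → u x ≡ 0ℚ) cq≡j (u∘c≡0 q)))
  ... | c⁺ , q , c⁺-inc , c⁺q≡j , c⁺≗c = record
    { columns = c⁺ ; increasing = c⁺-inc
    ; det≢0 = subst (_≢ 0ℚ) (sym det⁺) (*-≢0 uj≢0 (*-≢0 (sgn≢0 (toℕ q)) det≢0))
    ; solve = λ v → solution v , punchIn-elim (λ q → rowComb A (solution v) (c⁺ q) ≡ v q) q (solves-q v) (solves-c v) }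
    where
    B : Fin (suc m) → Fin (suc m) → ℚ
    B i q = A i (c⁺ q)

    C : Fin (suc m) → ℚ
    C = cofactor (B ∘ suc)

    u∘c⁺≡0 : ∀ i → u (c⁺ (punchIn q i)) ≡ 0ℚ
    u∘c⁺≡0 i = trans (cong u (c⁺≗c i)) (u∘c≡0 i)

    -- By `cramer₀` the determinant is `u` paired with the cofactors. Since `u` vanishes on the old
    -- columns, only the new column contributes, and its minor is the old determinant.
    det⁺ : detℚ (suc m) B ≡ u j * (sgn (toℕ q) * detℚ m (λ i q → A (suc i) (c q)))
    det⁺ = begin
      detℚ (suc m) B
        ≡⟨ *-identityˡ (detℚ (suc m) B) ⟨
      1ℚ * detℚ (suc m) B
        ≡⟨ cramer₀ B d ⟨
      ∑ℚ (λ q → u (c⁺ q) * C q)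
        ≡⟨ ∑-remove q (λ q → u (c⁺ q) * C q) ⟩
      u (c⁺ q) * C q + ∑ℚ (λ i → u (c⁺ (punchIn q i)) * C (punchIn q i))
        ≡⟨ cong (λ x → u (c⁺ q) * C q + x) (∑-zero λ i → trans (cong (_* C (punchIn q i)) (u∘c⁺≡0 i)) (*-zeroˡ (C (punchIn q i)))) ⟩
      u (c⁺ q) * C q + 0ℚ
        ≡⟨ +-identityʳ (u (c⁺ q) * C q) ⟩
      u (c⁺ q) * C q
        ≡⟨ cong₂ _*_ (cong u c⁺q≡j) (cong (sgn (toℕ q) *_) (detℚ-cong λ i p → cong (A (suc i)) (c⁺≗c p))) ⟩
      _ ∎

    instance
      uj-nonZero : NonZero (u j)
      uj-nonZero = ≢-nonZero uj≢0

    module _ (v : Fin (suc m) → ℚ) where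
      x : Fin m → ℚ
      x = proj₁ (solve (v ∘ punchIn q))

      -- Solve on the old columns without the first row, then add a multiple of `d`: this changes
      -- nothing there, and `α` is chosen to correct the value in column `j`.
      e α : ℚ
      e = rowComb (A ∘ suc) x j
      α = (v q - e) * 1/ u j

      solution : Fin (suc m) → ℚ
      solution i = (0ℚ ∷ x) i + α * d i

      rowComb-solution : ∀ k → rowComb A solution k ≡ rowComb (A ∘ suc) x k + α * u k
      rowComb-solution k = trans (∑-*-linear (λ i → A i k) (0ℚ ∷ x) α d)
        (cong (_+ α * u k) (trans (cong (_+ rowComb (A ∘ suc) x k) (*-zeroʳ (A zero k))) (+-identityˡ (rowComb (A ∘ suc) x k))))

      solves-q : rowComb A solution (c⁺ q) ≡ v q
      solves-q = begin
        rowComb A solution (c⁺ q)          ≡⟨ cong (rowComb A solution) c⁺q≡j ⟩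
        rowComb A solution j               ≡⟨ rowComb-solution j ⟩
        e + (v q - e) * 1/ u j * u j       ≡⟨ cong (e +_) (*-assoc (v q - e) (1/ u j) (u j)) ⟩
        e + (v q - e) * (1/ u j * u j)     ≡⟨ cong (λ w → e + (v q - e) * w) (*-inverseˡ (u j)) ⟩
        e + (v q - e) * 1ℚ                 ≡⟨ cancel e (v q) ⟩
        v q                                ∎
        where
        cancel : ∀ e w → e + (w + - e) * 1ℚ ≡ w
        cancel = solve-∀ ring

      solves-c : ∀ i → rowComb A solution (c⁺ (punchIn q i)) ≡ v (punchIn q i)
      solves-c i = begin
        rowComb A solution (c⁺ (punchIn q i))         ≡⟨ cong (rowComb A solution) (c⁺≗c i) ⟩
        rowComb A solution (c i)                      ≡⟨ rowComb-solution (c i) ⟩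
        rowComb (A ∘ suc) x (c i) + α * u (c i)       ≡⟨ cong₂ (λ a b → a + α * b) {x = rowComb (A ∘ suc) x (c i)} (proj₂ (solve (v ∘ punchIn q)) i) (u∘c≡0 i) ⟩
        v (punchIn q i) + α * 0ℚ                      ≡⟨ cong (v (punchIn q i) +_) (*-zeroʳ α) ⟩
        v (punchIn q i) + 0ℚ                          ≡⟨ +-identityʳ (v (punchIn q i)) ⟩
        v (punchIn q i)                               ∎

  extend : Dependent A ⊎ NonsingularColumns A
  extend with Fin.any? (λ j → ¬? (u j ≟ 0ℚ))
  ... | yes (j , uj≢0) = inj₂ (extendBy j uj≢0)
  ... | no ∄uj≢0 = inj₁ (d , (zero , λ ()) , λ j → decidable-stable (u j ≟ 0ℚ) λ uj≢0 → ∄uj≢0 (j , uj≢0))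

punchIn-increasing : (q : Fin (suc k)) → StrictlyIncreasing (punchIn q)
punchIn-increasing q i j i<j = ℕ.≰⇒> λ j≤i → ℕ.<⇒≱ i<j (Fin.punchIn-cancel-≤ q j i j≤i)

toℚ : Matℤ m n → Fin m → Fin n → ℚ
toℚ A i j = ℤ→ℚ (A i j)

-- Arithmetic of p-adic rationals, and p-adic solutions of nonsingular systems.

module PAdic (p : ℕ) where

  power : ℕ → ℚ
  power t = ℤ→ℚ (ℤ.+ (p ℕ.^ t))

  power-+ : ∀ s t → power (s ℕ.+ t) ≡ power s * power t
  power-+ s t = begin
    ℤ→ℚ (ℤ.+ (p ℕ.^ (s ℕ.+ t)))              ≡⟨ cong (ℤ→ℚ ∘ ℤ.+_) (ℕ.^-distribˡ-+-* p s t) ⟩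
    ℤ→ℚ (ℤ.+ (p ℕ.^ s ℕ.* p ℕ.^ t))          ≡⟨ cong ℤ→ℚ (ℤ.pos-* (p ℕ.^ s) (p ℕ.^ t)) ⟩
    ℤ→ℚ (ℤ.+ (p ℕ.^ s) ℤ.* ℤ.+ (p ℕ.^ t))      ≡⟨ ℤ→ℚ-* (ℤ.+ (p ℕ.^ s)) (ℤ.+ (p ℕ.^ t)) ⟩
    power s * power t                      ∎
    where open ≡-Reasoning

  pAdic-ℤ : ∀ a → IsPAdic p (ℤ→ℚ a)
  pAdic-ℤ a = a , 0 , *-identityʳ (ℤ→ℚ a)

  pAdic-+ : ∀ x y → IsPAdic p x → IsPAdic p y → IsPAdic p (x + y)
  pAdic-+ x y (a , s , xpˢ≡a) (b , t , ypᵗ≡b) = a ℤ.* ℤ.+ (p ℕ.^ t) ℤ.+ b ℤ.* ℤ.+ (p ℕ.^ s) , s ℕ.+ t , (begin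
    (x + y) * power (s ℕ.+ t)                    ≡⟨ cong ((x + y) *_) (power-+ s t) ⟩
    (x + y) * (power s * power t)                ≡⟨ rearrange x y (power s) (power t) ⟩
    x * power s * power t + y * power t * power s ≡⟨ cong₂ (λ a b → a * power t + b * power s) xpˢ≡a ypᵗ≡b ⟩
    ℤ→ℚ a * power t + ℤ→ℚ b * power s            ≡⟨ cong₂ _+_ (ℤ→ℚ-* a (ℤ.+ (p ℕ.^ t))) (ℤ→ℚ-* b (ℤ.+ (p ℕ.^ s))) ⟨
    ℤ→ℚ (a ℤ.* ℤ.+ (p ℕ.^ t)) + ℤ→ℚ (b ℤ.* ℤ.+ (p ℕ.^ s)) ≡⟨ ℤ→ℚ-+ (a ℤ.* ℤ.+ (p ℕ.^ t)) (b ℤ.* ℤ.+ (p ℕ.^ s)) ⟨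
    _ ∎)
    where
    open ≡-Reasoning
    rearrange : ∀ x y s t → (x + y) * (s * t) ≡ x * s * t + y * t * s
    rearrange = solve-∀ ring

  pAdic-* : ∀ x y → IsPAdic p x → IsPAdic p y → IsPAdic p (x * y)
  pAdic-* x y (a , s , xpˢ≡a) (b , t , ypᵗ≡b) = a ℤ.* b , s ℕ.+ t , (begin
    x * y * power (s ℕ.+ t)        ≡⟨ cong (x * y *_) (power-+ s t) ⟩
    x * y * (power s * power t)    ≡⟨ rearrange x y (power s) (power t) ⟩
    (x * power s) * (y * power t)  ≡⟨ cong₂ _*_ xpˢ≡a ypᵗ≡b ⟩
    ℤ→ℚ a * ℤ→ℚ b                  ≡⟨ ℤ→ℚ-* a b ⟨
    ℤ→ℚ (a ℤ.* b)                  ∎)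
    where
    open ≡-Reasoning
    rearrange : ∀ x y s t → x * y * (s * t) ≡ (x * s) * (y * t)
    rearrange = solve-∀ ring

  pAdic-neg : ∀ x → IsPAdic p x → IsPAdic p (- x)
  pAdic-neg x (a , s , xpˢ≡a) = ℤ.- a , s , (begin
    - x * power s    ≡⟨ neg-distribˡ-* x (power s) ⟨
    - (x * power s)  ≡⟨ cong -_ xpˢ≡a ⟩
    - ℤ→ℚ a          ≡⟨ ℤ→ℚ-neg a ⟨
    ℤ→ℚ (ℤ.- a)      ∎)
    where open ≡-Reasoning

  pAdic-∑ : (f : Fin n → ℚ) → (∀ i → IsPAdic p (f i)) → IsPAdic p (∑ℚ f)
  pAdic-∑ {zero}  f f-pAdic = pAdic-ℤ (ℤ.+ 0)
  pAdic-∑ {suc n} f f-pAdic = pAdic-+ (f zero) (∑ℚ (f ∘ suc)) (f-pAdic zero) (pAdic-∑ (f ∘ suc) (f-pAdic ∘ suc))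

  pAdic-cancel-power : ∀ t x → IsPAdic p (x * power t) → IsPAdic p x
  pAdic-cancel-power t x (a , s , eq) = a , t ℕ.+ s , (begin
    x * power (t ℕ.+ s)      ≡⟨ cong (x *_) (power-+ t s) ⟩
    x * (power t * power s)  ≡⟨ *-assoc x (power t) (power s) ⟨
    x * power t * power s    ≡⟨ eq ⟩
    ℤ→ℚ a                    ∎)
    where open ≡-Reasoning

  -- Meant for `d` a nonzero subdeterminant: dividing by it only raises the exponent in the
  -- denominator, and a minus sign is absorbed by `pAdic-neg`.
  pAdic-cancel-± : ∀ {d} → (∃ λ t → d ≡ ℤ.+ (p ℕ.^ t)) ⊎ (∃ λ t → d ≡ ℤ.- (ℤ.+ (p ℕ.^ t))) →
    ∀ x → IsPAdic p (x * ℤ→ℚ d) → IsPAdic p x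
  pAdic-cancel-± (inj₁ (t , refl)) x xd-pAdic = pAdic-cancel-power t x xd-pAdic
  pAdic-cancel-± (inj₂ (t , refl)) x xd-pAdic = pAdic-cancel-power t x
    (subst (IsPAdic p) -[x*-pᵗ]≡x*pᵗ (pAdic-neg (x * ℤ→ℚ (ℤ.- (ℤ.+ (p ℕ.^ t)))) xd-pAdic))
    where
    open ≡-Reasoning
    cancel : ∀ x y → - (x * - y) ≡ x * y
    cancel = solve-∀ ring
    -[x*-pᵗ]≡x*pᵗ : - (x * ℤ→ℚ (ℤ.- (ℤ.+ (p ℕ.^ t)))) ≡ x * power t
    -[x*-pᵗ]≡x*pᵗ = begin
      - (x * ℤ→ℚ (ℤ.- (ℤ.+ (p ℕ.^ t))))  ≡⟨ cong (λ y → - (x * y)) (ℤ→ℚ-neg (ℤ.+ (p ℕ.^ t))) ⟩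
      - (x * - power t)                ≡⟨ cancel x (power t) ⟩
      x * power t                      ∎

  pAdic-cofactor : (R : Matℤ n (suc n)) → ∀ j → IsPAdic p (cofactor (toℚ R) j)
  pAdic-cofactor {n} R j = pAdic-* (sgn (toℕ j)) (detℚ n (λ r c → toℚ R r (punchIn j c)))
    (subst (IsPAdic p) (ℤ→ℚ-sign (toℕ j)) (pAdic-ℤ (sign (toℕ j))))
    (subst (IsPAdic p) (ℤ→ℚ-det (λ r c → R r (punchIn j c))) (pAdic-ℤ (det _ (λ r c → R r (punchIn j c)))))

  subdets-rows : (A : Matℤ m n) (ρ : Fin k → Fin m) → StrictlyIncreasing ρ →
    SubdetsPowersOf p A → SubdetsPowersOf p (A ∘ ρ)
  subdets-rows A ρ ρ-inc S k r c r-inc c-inc =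
    S k (ρ ∘ r) c (λ i j i<j → ρ-inc (r i) (r j) (r-inc i j i<j)) c-inc

  -- Induction on the rows. The right-hand side is assumed p-adic rather than integral because
  -- moving the first row across subtracts multiples of the p-adic number `z zero`.
  pAdic-solution : (A : Matℤ m n) → SubdetsPowersOf p A →
    (c : Fin m → Fin n) → StrictlyIncreasing c → detℚ m (λ i q → toℚ A i (c q)) ≢ 0ℚ →
    (z : Fin m → ℚ) → (∀ q → IsPAdic p (rowComb (toℚ A) z (c q))) → IsPAdicVec p z
  pAdic-solution {suc m} A S c c-inc det≢0 z w-pAdic = λ { zero → z₀-pAdic ; (suc i) → z₊-pAdic i }
    where
    M : Matℤ (suc m) (suc m)
    M i q = A i (c q)

    w C : Fin (suc m) → ℚ
    w q = rowComb (toℚ A) z (c q)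
    C = cofactor (toℚ M ∘ suc)

    det-±power : (∃ λ t → det (suc m) M ≡ ℤ.+ (p ℕ.^ t)) ⊎ (∃ λ t → det (suc m) M ≡ ℤ.- (ℤ.+ (p ℕ.^ t)))
    det-±power with S (suc m) (λ i → i) c (λ _ _ i<j → i<j) c-inc
    ... | inj₁ det≡0    = contradiction (trans (sym (ℤ→ℚ-det M)) (cong ℤ→ℚ det≡0)) det≢0
    ... | inj₂ ±power   = ±power

    z₀-pAdic : IsPAdic p (z zero)
    z₀-pAdic = pAdic-cancel-± det-±power (z zero)
      (subst (IsPAdic p) (trans (cramer₀ (toℚ M) z) (cong (z zero *_) (sym (ℤ→ℚ-det M))))
        (pAdic-∑ (λ q → w q * C q) λ q → pAdic-* (w q) (C q) (w-pAdic q) (pAdic-cofactor (M ∘ suc) q)))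

    -- A nonzero determinant has a nonzero term in its expansion; dropping that column leaves a
    -- nonsingular system for the remaining rows.
    nonzeroTerm : ∃ λ q → toℚ M zero q * C q ≢ 0ℚ
    nonzeroTerm with Fin.any? (λ q → ¬? (toℚ M zero q * C q ≟ 0ℚ))
    ... | yes ∃≢0 = ∃≢0
    ... | no ∄≢0  = contradiction
      (∑-zero λ q → decidable-stable (toℚ M zero q * C q ≟ 0ℚ) λ ≢0 → ∄≢0 (q , ≢0)) det≢0

    q : Fin (suc m)
    q = proj₁ nonzeroTerm

    minor≢0 : detℚ m (λ i j → toℚ M (suc i) (punchIn q j)) ≢ 0ℚ
    minor≢0 minor≡0 = proj₂ nonzeroTerm
      (trans (cong (λ d → toℚ M zero q * (sgn (toℕ q) * d)) minor≡0)
        (trans (cong (toℚ M zero q *_) (*-zeroʳ (sgn (toℕ q)))) (*-zeroʳ (toℚ M zero q))))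

    subtract : ∀ a b → a + b + - a ≡ b
    subtract = solve-∀ ring

    z₊-pAdic : IsPAdicVec p (z ∘ suc)
    z₊-pAdic = pAdic-solution (A ∘ suc) (subdets-rows A suc (λ i j → s≤s) S) (c ∘ punchIn q)
      (λ i j i<j → c-inc (punchIn q i) (punchIn q j) (punchIn-increasing q i j i<j)) minor≢0 (z ∘ suc)
      w₊-pAdic
      where
      w₊-pAdic : ∀ j → IsPAdic p (rowComb (toℚ A ∘ suc) (z ∘ suc) (c (punchIn q j)))
      w₊-pAdic j = subst (IsPAdic p) (subtract x (rowComb (toℚ A ∘ suc) (z ∘ suc) (c q′)))
        (pAdic-+ (w q′) (- x) (w-pAdic q′)
          (pAdic-neg x (pAdic-* (toℚ M zero q′) (z zero) (pAdic-ℤ (M zero q′)) z₀-pAdic)))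
        where
        q′ : Fin (suc m)
        q′ = punchIn q j
        x : ℚ
        x = toℚ M zero q′ * z zero

-- The ratio test: moving from a positive vector until an entry vanishes.

+-nonNeg : ∀ {x y} → 0ℚ ≤ x → 0ℚ ≤ y → 0ℚ ≤ x + y
+-nonNeg = +-mono-≤ {0ℚ} {_} {0ℚ}

*-nonNeg : ∀ {x y} → 0ℚ ≤ x → 0ℚ ≤ y → 0ℚ ≤ x * y
*-nonNeg {x} {y} 0≤x 0≤y =
  nonNegative⁻¹ (x * y) {{nonNeg*nonNeg⇒nonNeg x {{nonNegative 0≤x}} y {{nonNegative 0≤y}}}}

crossing : ∀ {a b} → 0ℚ < a → b < 0ℚ → ∃ λ t → 0ℚ < t × a + t * b ≡ 0ℚ
crossing {a} {b} 0<a b<0 = a * 1/ (- b) , positive⁻¹ (a * 1/ (- b)) , (begin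
  a + a * 1/ (- b) * b          ≡⟨ rearrange a (1/ (- b)) b ⟩
  a + - (a * (1/ (- b) * - b))  ≡⟨ cong (λ x → a + - (a * x)) (*-inverseˡ (- b)) ⟩
  a + - (a * 1ℚ)                ≡⟨ cong (λ x → a + - x) (*-identityʳ a) ⟩
  a + - a                       ≡⟨ +-inverseʳ a ⟩
  0ℚ                            ∎)
  where
  open ≡-Reasoning
  rearrange : ∀ a c b → a + a * c * b ≡ a + - (a * (c * - b))
  rearrange = solve-∀ ring
  instance
    a-pos : Positive a
    a-pos = positive 0<a
    -b-pos : Positive (- b)
    -b-pos = positive (neg-antimono-< b<0)
    -b-nonZero : NonZero (- b)
    -b-nonZero = pos⇒nonZero (- b)
    1/-b-pos : Positive (1/ (- b))
    1/-b-pos = 1/pos⇒pos (- b)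
    t-pos : Positive (a * 1/ (- b))
    t-pos = pos*pos⇒pos a (1/ (- b))

-- Nonnegativity only; the dual equations are preserved by taking `z` in the kernel, see
-- `dualFeasible-shift`.
Feasible : (y z : Fin m → ℚ) → ℚ → Set
Feasible y z t = ∀ i → 0ℚ ≤ y i + t * z i

BoundaryStep : (y z : Fin m → ℚ) → Set
BoundaryStep y z = ∃ λ t → 0ℚ < t × Feasible y z t × ∃ λ i → y i + t * z i ≡ 0ℚ

nonNeg-coordinate : ∀ {t y z} → 0ℚ < t → 0ℚ < y → 0ℚ ≤ z → 0ℚ ≤ y + t * z
nonNeg-coordinate {t} {y} {z} t>0 y>0 z≥0 =
  +-nonNeg {y} {t * z} (<⇒≤ y>0) (*-nonNeg {t} {z} (<⇒≤ t>0) z≥0)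

*-shrink-nonPos : ∀ {s t z} y → s ≤ t → z ≤ 0ℚ → y + t * z ≤ y + s * z
*-shrink-nonPos {z = z} y s≤t z≤0 = +-monoʳ-≤ y (*-monoʳ-≤-nonPos z {{nonPositive z≤0}} s≤t)

-- A coordinate with `z` nonnegative never drops below its positive start; one with `z` nonpositive
-- is at least as large at the earlier time `s`.
nonNeg-shrink : ∀ {s t y z} → 0ℚ < s → s ≤ t → 0ℚ < y → 0ℚ ≤ y + t * z → 0ℚ ≤ y + s * z
nonNeg-shrink {s} {t} {y} {z} s>0 s≤t y>0 y+tz≥0 with ≤-total 0ℚ z
... | inj₁ z≥0 = nonNeg-coordinate {s} {y} {z} s>0 y>0 z≥0
... | inj₂ z≤0 = ≤-trans y+tz≥0 (*-shrink-nonPos {s} {t} {z} y s≤t z≤0)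

module _ (y z : Fin (suc m) → ℚ) (y>0 : ∀ i → 0ℚ < y i) where

  stepToHead : z zero < 0ℚ → (∀ s → 0ℚ < s → y zero + s * z zero ≡ 0ℚ → Feasible (y ∘ suc) (z ∘ suc) s) →
    BoundaryStep y z
  stepToHead z₀<0 feasible = s , s>0 , y+sz≥0 , zero , y₀+sz₀≡0
    where
    headCrossing : ∃ λ s → 0ℚ < s × y zero + s * z zero ≡ 0ℚ
    headCrossing = crossing (y>0 zero) z₀<0
    s : ℚ
    s = proj₁ headCrossing
    s>0 : 0ℚ < s
    s>0 = proj₁ (proj₂ headCrossing)
    y₀+sz₀≡0 : y zero + s * z zero ≡ 0ℚ
    y₀+sz₀≡0 = proj₂ (proj₂ headCrossing)
    y+sz≥0 : Feasible y z s
    y+sz≥0 zero    = ≤-reflexive (sym y₀+sz₀≡0)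
    y+sz≥0 (suc i) = feasible s s>0 y₀+sz₀≡0 i

  ratioTest-unbounded : (∀ i → 0ℚ ≤ z (suc i)) → (∀ i → 0ℚ ≤ z i) ⊎ BoundaryStep y z
  ratioTest-unbounded z₊≥0 with 0ℚ ≤? z zero
  ... | yes z₀≥0 = inj₁ λ { zero → z₀≥0 ; (suc i) → z₊≥0 i }
  ... | no z₀≱0  = inj₂ (stepToHead (≰⇒> z₀≱0) λ s s>0 _ i →
    nonNeg-coordinate {s} {y (suc i)} {z (suc i)} s>0 (y>0 (suc i)) (z₊≥0 i))

  -- If the head is still nonnegative at time `t`, that step stands. Otherwise the head decreases
  -- and reaches zero no later than `t`, so the tail is still nonnegative at that moment.
  ratioTest-bounded : BoundaryStep (y ∘ suc) (z ∘ suc) → BoundaryStep y z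
  ratioTest-bounded (t , t>0 , y₊+tz₊≥0 , i₀ , y+tz≡0) = compare (0ℚ ≤? y zero + t * z zero)
    where
    module _ (y₀+tz₀≱0 : ¬ 0ℚ ≤ y zero + t * z zero) where
      z₀<0 : z zero < 0ℚ
      z₀<0 = ≰⇒> λ z₀≥0 → y₀+tz₀≱0 (nonNeg-coordinate {t} {y zero} {z zero} t>0 (y>0 zero) z₀≥0)

      s≤t : ∀ s → y zero + s * z zero ≡ 0ℚ → s ≤ t
      s≤t s y₀+sz₀≡0 = ≮⇒≥ λ t<s → y₀+tz₀≱0 (subst (_≤ y zero + t * z zero) y₀+sz₀≡0
        (*-shrink-nonPos {t} {s} {z zero} (y zero) (<⇒≤ t<s) (<⇒≤ z₀<0)))

    compare : Dec (0ℚ ≤ y zero + t * z zero) → BoundaryStep y z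
    compare (yes y₀+tz₀≥0) = t , t>0 , (λ { zero → y₀+tz₀≥0 ; (suc i) → y₊+tz₊≥0 i }) , suc i₀ , y+tz≡0
    compare (no y₀+tz₀≱0)  = stepToHead (z₀<0 y₀+tz₀≱0) λ s s>0 y₀+sz₀≡0 i →
      nonNeg-shrink {s} {t} {y (suc i)} {z (suc i)} s>0 (s≤t y₀+tz₀≱0 s y₀+sz₀≡0) (y>0 (suc i)) (y₊+tz₊≥0 i)

-- The minimum ratio rule of the simplex method, with the minimum updated one coordinate at a time.
ratioTest : (y z : Fin m → ℚ) → (∀ i → 0ℚ < y i) → (∀ i → 0ℚ ≤ z i) ⊎ BoundaryStep y z
ratioTest {zero}  y z y>0 = inj₁ λ ()
ratioTest {suc m} y z y>0 with ratioTest (y ∘ suc) (z ∘ suc) (y>0 ∘ suc)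
... | inj₁ z₊≥0 = ratioTest-unbounded y z y>0 z₊≥0
... | inj₂ step = inj₂ (ratioTest-bounded y z y>0 step)

feasibleStep : (y z : Fin m → ℚ) → (∀ i → 0ℚ < y i) → ∃ λ t → 0ℚ < t × Feasible y z t
feasibleStep y z y>0 with ratioTest y z y>0
-- No coordinate decreases, so any positive step would do.
... | inj₁ z≥0 = 1ℚ , positive⁻¹ 1ℚ , λ i →
  nonNeg-coordinate {1ℚ} {y i} {z i} (positive⁻¹ 1ℚ) (y>0 i) (z≥0 i)
... | inj₂ (t , t>0 , y+tz≥0 , _) = t , t>0 , y+tz≥0

-- As `z` is nonzero, `z` and its negative are not both nonnegative, so one of them reaches the
-- boundary. A step along the negative has its sign turned, hence `t` may be negative.
stepToBoundary : (y z : Fin m → ℚ) → (∀ i → 0ℚ < y i) → (∃ λ i → z i ≢ 0ℚ) →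
  ∃ λ t → Feasible y z t × ∃ λ i → y i + t * z i ≡ 0ℚ
stepToBoundary y z y>0 (i , zᵢ≢0) with ratioTest y z y>0 | ratioTest y (-_ ∘ z) y>0
... | inj₂ (t , _ , y+tz≥0 , y+tz≡0) | _ = t , y+tz≥0 , y+tz≡0
... | inj₁ z≥0 | inj₁ -z≥0 = contradiction (≤-antisym zᵢ≤0 (z≥0 i)) zᵢ≢0
  where
  zᵢ≤0 : z i ≤ 0ℚ
  zᵢ≤0 = subst (_≤ 0ℚ) (neg-involutive (z i)) (neg-antimono-≤ (-z≥0 i))
... | inj₁ _ | inj₂ (t , _ , y-tz≥0 , i₀ , y-tz≡0) =
  - t , (λ i → subst (0ℚ ≤_) (flip (y i) t (z i)) (y-tz≥0 i)) , i₀ , trans (sym (flip (y i₀) t (z i₀))) y-tz≡0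
  where
  flip : ∀ y t z → y + t * - z ≡ y + - t * z
  flip = solve-∀ ring

-- Optimality along kernel directions.

dualFeasible-shift : {A : Matℤ m n} {w : Fin n → ℤ} {y z : Fin m → ℚ} (t : ℚ) →
  DualFeasible A w y → (∀ j → rowComb (toℚ A) z j ≡ 0ℚ) →
  Feasible y z t → DualFeasible A w (λ i → y i + t * z i)
dualFeasible-shift {A = A} {w} {y} {z} t (_ , Ay≡w) Az≡0 y+tz≥0 = y+tz≥0 , λ j → begin
  rowComb (toℚ A) (λ i → y i + t * z i) j            ≡⟨ ∑-*-linear (λ i → toℚ A i j) y t z ⟩
  rowComb (toℚ A) y j + t * rowComb (toℚ A) z j      ≡⟨ cong₂ (λ a b → a + t * b) (Ay≡w j) (Az≡0 j) ⟩
  ℤ→ℚ (w j) + t * 0ℚ                                 ≡⟨ cong (ℤ→ℚ (w j) +_) (*-zeroʳ t) ⟩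
  ℤ→ℚ (w j) + 0ℚ                                     ≡⟨ +-identityʳ (ℤ→ℚ (w j)) ⟩
  ℤ→ℚ (w j)                                          ∎
  where open ≡-Reasoning

x≤x+y⇒0≤y : ∀ x y → x ≤ x + y → 0ℚ ≤ y
x≤x+y⇒0≤y x y x≤x+y = subst₂ _≤_ (+-inverseˡ x) (cancel x y) (+-monoʳ-≤ (- x) x≤x+y)
  where
  cancel : ∀ x y → - x + (x + y) ≡ y
  cancel = solve-∀ ring

module _ {A : Matℤ m n} {b : Fin m → ℤ} {w : Fin n → ℤ} {y : Fin m → ℚ} (y-opt : DualOptimal A b w y)
         (y>0 : ∀ i → 0ℚ < y i) where

  -- Positivity of `y` allows some step `t > 0` along `z`. The objective does not drop there, so
  -- `t * dualObj b z` is nonnegative, and `t` cancels.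
  dualObj-kernel-nonNeg : (z : Fin m → ℚ) → (∀ j → rowComb (toℚ A) z j ≡ 0ℚ) → 0ℚ ≤ dualObj b z
  dualObj-kernel-nonNeg z Az≡0 with feasibleStep y z y>0
  ... | t , t>0 , y+tz≥0 = *-cancelˡ-≤-pos t {{positive t>0}}
    (subst (_≤ t * dualObj b z) (sym (*-zeroʳ t))
      (x≤x+y⇒0≤y (dualObj b y) (t * dualObj b z)
        (subst (dualObj b y ≤_) (∑-*-linear (ℤ→ℚ ∘ b) y t z)
          (proj₂ y-opt (λ i → y i + t * z i) (dualFeasible-shift {A = A} {w} {y} {z} t (proj₁ y-opt) Az≡0 y+tz≥0)))))

  dualObj-kernel : (z : Fin m → ℚ) → (∀ j → rowComb (toℚ A) z j ≡ 0ℚ) → dualObj b z ≡ 0ℚ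
  dualObj-kernel z Az≡0 = ≤-antisym
    (subst (_≤ 0ℚ) (neg-involutive (dualObj b z))
      (neg-antimono-≤ (subst (0ℚ ≤_) (∑-*-neg (ℤ→ℚ ∘ b) z) (dualObj-kernel-nonNeg (-_ ∘ z)
        λ j → trans (∑-*-neg (λ i → toℚ A i j) z) (cong -_ (Az≡0 j))))))
    (dualObj-kernel-nonNeg z Az≡0)

-- Deleting a row whose dual variable is zero.

∑-*-remove : (i : Fin (suc m)) (a y : Fin (suc m) → ℚ) → y i ≡ 0ℚ →
  ∑ℚ (λ k → a k * y k) ≡ ∑ℚ (λ k → a (punchIn i k) * y (punchIn i k))
∑-*-remove i a y yᵢ≡0 = begin
  ∑ℚ (λ k → a k * y k)  ≡⟨ ∑-remove i (λ k → a k * y k) ⟩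
  a i * y i + S         ≡⟨ cong (λ x → a i * x + S) yᵢ≡0 ⟩
  a i * 0ℚ + S          ≡⟨ cong (_+ S) (*-zeroʳ (a i)) ⟩
  0ℚ + S                ≡⟨ +-identityˡ S ⟩
  S                     ∎
  where
  open ≡-Reasoning
  S : ℚ
  S = ∑ℚ (λ k → a (punchIn i k) * y (punchIn i k))

∑-*-insertAt : (i : Fin (suc m)) (a : Fin (suc m) → ℚ) (y : Fin m → ℚ) →
  ∑ℚ (λ k → a k * insertAt y i 0ℚ k) ≡ ∑ℚ (λ k → a (punchIn i k) * y k)
∑-*-insertAt i a y = trans (∑-*-remove i a (insertAt y i 0ℚ) (insertAt-lookup y i 0ℚ))
  (∑-cong λ k → cong (a (punchIn i k) *_) (insertAt-punchIn y i 0ℚ k))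

insertAt-elim : (P : ℚ → Set) (y : Fin m → ℚ) (i : Fin (suc m)) → P 0ℚ → (∀ k → P (y k)) →
  ∀ k → P (insertAt y i 0ℚ k)
insertAt-elim P y i P0 Py = punchIn-elim (λ k → P (insertAt y i 0ℚ k)) i
  (subst P (sym (insertAt-lookup y i 0ℚ)) P0)
  (λ k → subst P (sym (insertAt-punchIn y i 0ℚ k)) (Py k))

dualFeasible-insertAt : {A : Matℤ (suc m) n} {w : Fin n → ℤ} {y : Fin m → ℚ} (i : Fin (suc m)) →
  DualFeasible (A ∘ punchIn i) w y → DualFeasible A w (insertAt y i 0ℚ)
dualFeasible-insertAt {A = A} {y = y} i (y≥0 , Ay≡w) =
  insertAt-elim (0ℚ ≤_) y i ≤-refl y≥0 , λ j → trans (∑-*-insertAt i (λ k → toℚ A k j) y) (Ay≡w j)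

-- A competitor of the smaller problem, extended by zero, is a competitor of the larger one with the
-- same objective value.
dualOptimal-remove : {A : Matℤ (suc m) n} {b : Fin (suc m) → ℤ} {w : Fin n → ℤ} {y : Fin (suc m) → ℚ}
  (i : Fin (suc m)) → y i ≡ 0ℚ → DualOptimal A b w y →
  DualOptimal (A ∘ punchIn i) (b ∘ punchIn i) w (y ∘ punchIn i)
dualOptimal-remove {A = A} {b} {w} {y} i yᵢ≡0 ((y≥0 , Ay≡w) , y-min) =
  (y≥0 ∘ punchIn i , λ j → trans (sym (∑-*-remove i (λ k → toℚ A k j) y yᵢ≡0)) (Ay≡w j)) ,
  λ x x-feas → subst₂ _≤_ (∑-*-remove i (ℤ→ℚ ∘ b) y yᵢ≡0) (∑-*-insertAt i (ℤ→ℚ ∘ b) x)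
    (y-min (insertAt x i 0ℚ) (dualFeasible-insertAt {A = A} {w} {x} i x-feas))

-- The induction on the number of rows.

module _ (p : ℕ) where
  open PAdic p

  PAdicOptimum : Matℤ m n → (Fin m → ℤ) → (Fin n → ℤ) → Set
  PAdicOptimum {m} A b w = ∃ λ (y : Fin m → ℚ) → DualOptimal A b w y × IsPAdicVec p y

  pAdicOptimum : (A : Matℤ m n) → SubdetsPowersOf p A → (b : Fin m → ℤ) (w : Fin n → ℤ) (y : Fin m → ℚ) →
    DualOptimal A b w y → PAdicOptimum A b w
  pAdicOptimum {zero}  A S b w y y-opt = y , y-opt , λ ()
  pAdicOptimum {suc m} A S b w y y-opt = main
    where
    onFace : (x : Fin (suc m) → ℚ) (i : Fin (suc m)) → x i ≡ 0ℚ → DualOptimal A b w x → PAdicOptimum A b w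
    onFace x i xᵢ≡0 x-opt = lift (pAdicOptimum (A ∘ punchIn i) (subdets-rows A (punchIn i) (punchIn-increasing i) S)
        (b ∘ punchIn i) w (x ∘ punchIn i) x↓-opt)
      where
      x↓-opt : DualOptimal (A ∘ punchIn i) (b ∘ punchIn i) w (x ∘ punchIn i)
      x↓-opt = dualOptimal-remove {A = A} {b} {w} {x} i xᵢ≡0 x-opt
      lift : PAdicOptimum (A ∘ punchIn i) (b ∘ punchIn i) w → PAdicOptimum A b w
      lift (v , (v-feas , v-min) , v-pAdic) =
        insertAt v i 0ℚ ,
        -- Optimality lifts through `x`: the restriction of `x` competes with `v` in the smaller
        -- problem, and `x` is no worse than any `u` in the larger one.
        (dualFeasible-insertAt {A = A} {w} {v} i v-feas , λ u u-feas → ≤-trans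
          (subst₂ _≤_ (sym (∑-*-insertAt i (ℤ→ℚ ∘ b) v)) (sym (∑-*-remove i (ℤ→ℚ ∘ b) x xᵢ≡0))
            (v-min (x ∘ punchIn i) (proj₁ x↓-opt)))
          (proj₂ x-opt u u-feas)) ,
        insertAt-elim (IsPAdic p) v i (pAdic-ℤ (ℤ.+ 0)) v-pAdic

    interior : (∀ i → 0ℚ < y i) → PAdicOptimum A b w
    interior y>0 with dependent-or-nonsingular (toℚ A)
    -- Here `y` itself is p-adic: on the selected columns it solves a nonsingular system with the
    -- integral right-hand side `w`.
    ... | inj₂ N = y , y-opt , pAdic-solution A S columns increasing det≢0 y
          λ q → subst (IsPAdic p) (sym (proj₂ (proj₁ y-opt) (columns q))) (pAdic-ℤ (w (columns q)))
      where open NonsingularColumns N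
    ... | inj₁ (z , z≢0 , Az≡0) with stepToBoundary y z y>0 z≢0
    -- The shifted point is again optimal, as the objective is constant along `z`, and it has a zero
    -- entry at `i`.
    ...   | t , y+tz≥0 , i , yᵢ+tzᵢ≡0 = onFace (λ i → y i + t * z i) i yᵢ+tzᵢ≡0
      (dualFeasible-shift {A = A} {w} {y} {z} t (proj₁ y-opt) Az≡0 y+tz≥0 ,
       λ u u-feas → subst (_≤ dualObj b u) (sym obj≡) (proj₂ y-opt u u-feas))
      where
      open ≡-Reasoning
      obj≡ : dualObj b (λ i → y i + t * z i) ≡ dualObj b y
      obj≡ = begin
        dualObj b (λ i → y i + t * z i)  ≡⟨ ∑-*-linear (ℤ→ℚ ∘ b) y t z ⟩
        dualObj b y + t * dualObj b z    ≡⟨ cong (λ x → dualObj b y + t * x) (dualObj-kernel {A = A} {b} {w} {y} y-opt y>0 z Az≡0) ⟩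
        dualObj b y + t * 0ℚ             ≡⟨ cong (dualObj b y +_) (*-zeroʳ t) ⟩
        dualObj b y + 0ℚ                 ≡⟨ +-identityʳ (dualObj b y) ⟩
        dualObj b y                      ∎

    main : PAdicOptimum A b w
    main with Fin.any? (λ i → y i ≟ 0ℚ)
    ... | yes (i , yᵢ≡0) = onFace y i yᵢ≡0 y-opt
    ... | no ∄yᵢ≡0       = interior λ i → ≰⇒> λ yᵢ≤0 → ∄yᵢ≡0 (i , ≤-antisym yᵢ≤0 (proj₁ (proj₁ y-opt) i))

theorem1p7 : (p : ℕ) → Prime p → (m n : ℕ) → (A : Matℤ m n) → SubdetsPowersOf p A →
    (b : Fin m → ℤ) → TotallyDualPAdic p A b
theorem1p7 p _ m n A S b w (y , y-opt) = pAdicOptimum p A S b w y y-opt
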